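{- Let $k\ge 2$, $p\in(0,1)$, $q=1-p$, and $M^{(k)}(z)=\sum_{n\ge1}M^{(k)}_n(p)z^n$. Then $$M^{(k)}(z)=\frac{z}{(1-z)^2}\left(k-\frac1q\right)+\frac{z}{1-z}\cdot\frac pq\cdot\frac{1}{1-\frac1q S^{(k)}(p^{k-1}qz)}$$ as formal power series in $z$.
   Context: Matchbox process: fix integers $k\ge 2$, $n\ge 1$ and $p\in(0,1)$, $q=1-p$. Initially $k$ boxes each contain $n$ matches. At each time step, independently of the past, with probability $p$ a match is removed from a box currently containing the largest number of matches, and with probability $q$ from a box currently containing the smallest number of matches (ties broken arbitrarily). The process is run until the first time some box is empty; the residue is the total number of matches in the other $k-1$ boxes at that time, and $M^{(k)}_n(p)$ is its expectation. For $i\ge1$, $s^{(k)}_i=\frac{k-1}{ki-1}\binom{ki-1}{i-1}$ and $S^{(k)}(z)=\sum_{i\ge1}s^{(k)}_iz^i$. -}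

module Defs where

open import Level using (Level; _⊔_) renaming (suc to lsuc)
open import Algebra.Bundles using (CommutativeRing)
open import Algebra.Apartness.Bundles using (HeytingField; HeytingCommutativeRing)
open import Data.Nat.Base as ℕ using (ℕ; zero; suc; z≤n; s≤s)
import Data.Nat.Properties as ℕ
open import Data.Nat.Combinatorics using (_C_)
open import Data.Fin.Base using (Fin; zero; suc; toℕ)
open import Data.List.Base as List using (List; []; _∷_; _++_)
open import Data.Vec.Base as Vec using (Vec; []; _∷_; lookup; updateAt; replicate)
open import Data.Vec.Functional as Vector using (Vector)
open import Data.Vec.Relation.Unary.Any using (Any; here; there; any?)
open import Data.Product.Base using (∃; _,_; proj₁; proj₂)
open import Data.Sum.Base using (_⊎_)
open import Relation.Binary.Core using (Rel)
open import Relation.Binary.Structures using (IsStrictPartialOrder)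
open import Relation.Binary.PropositionalEquality as ≡ using (_≡_; _≢_)
open import Relation.Nullary using (Dec; yes; no; contradiction)
open import Function.Base using (_∘_)

private
  variable
    k n : ℕ

-- Constructive ordered fields: apartness from 0# gives invertibility and
-- x # y means x < y or y < x. The real numbers are a model, both
-- classically and constructively.

record OrderedField c ℓ₁ ℓ₂ : Set (lsuc (c ⊔ ℓ₁ ⊔ ℓ₂)) where
  field
    heytingField : HeytingField c ℓ₁ ℓ₂

  open HeytingField heytingField public

  infix 4 _<_
  field
    _<_                  : Rel Carrier ℓ₂
    isStrictPartialOrder : IsStrictPartialOrder _≈_ _<_
    #⇒<⊎>                : ∀ {x y} → x # y → x < y ⊎ y < x
    <⇒#                  : ∀ {x y} → x < y → x # y
    0<1                  : 0# < 1#
    +-monoʳ-<            : ∀ x {y z} → y < z → x + y < x + z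
    *-pos                : ∀ {x y} → 0# < x → 0# < y → 0# < x * y

  commutativeRing : CommutativeRing c ℓ₁
  commutativeRing = HeytingCommutativeRing.commutativeRing heytingCommutativeRing

  open CommutativeRing commutativeRing public
    using (ring; semiring; +-monoid; +-rawMonoid)

  module StrictOrder = IsStrictPartialOrder isStrictPartialOrder

Config : ℕ → Set
Config k = Vec ℕ k

SomeEmpty : Config k → Set
SomeEmpty = Any (_≡ 0)

someEmpty? : (c : Config k) → Dec (SomeEmpty c)
someEmpty? = any? (ℕ._≟ 0)

data Draw : Set where
  largest smallest : Draw

IsChoice : Draw → Config k → Fin k → Set
IsChoice largest  c i = ∀ j → lookup c j ℕ.≤ lookup c i
IsChoice smallest c i = ∀ j → lookup c i ℕ.≤ lookup c j

-- An arbitrary way to break ties: the box may depend on the whole past.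
-- The list holds the earlier draws, most recent first.
TieBreaking : ℕ → Set
TieBreaking k = List Draw → (d : Draw) (c : Config k) → ∃ (IsChoice d c)

removeFrom : Config k → Fin k → Config k
removeFrom c i = updateAt c i ℕ.pred

-- The process frozen at the first time some box is empty.
run : TieBreaking k → List Draw → Config k → Vec Draw n → Config k
run τ past c []      = c
run τ past c (d ∷ ω) with someEmpty? c
... | yes _ = c
... | no  _ = run τ (d ∷ past) (removeFrom c (proj₁ (τ past d c))) ω

-- k * n draws always suffice to empty a box (see stops), so the process is
-- determined by that many draws.
finalConfig : (k n : ℕ) → TieBreaking k → Vec Draw (k ℕ.* n) → Config k
finalConfig k n τ ω = run τ [] (replicate k n) ω

-- An empty box contributes nothing, so the total over the other boxes is
-- the total over all boxes.
residue : Config k → ℕ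
residue = Vec.sum

anyEmpty : (c : Config k) (i : Fin k) → lookup c i ≡ 0 → SomeEmpty c
anyEmpty (x ∷ c) zero    eq = here eq
anyEmpty (x ∷ c) (suc i) eq = there (anyEmpty c i eq)

sum-removeFrom : (c : Config k) (i : Fin k) → lookup c i ≢ 0 →
                 suc (Vec.sum (removeFrom c i)) ≡ Vec.sum c
sum-removeFrom (zero  ∷ c) zero    ne = contradiction ≡.refl ne
sum-removeFrom (suc x ∷ c) zero    ne = ≡.refl
sum-removeFrom (x     ∷ c) (suc i) ne =
  ≡.trans (≡.sym (ℕ.+-suc x _)) (≡.cong (x ℕ.+_) (sum-removeFrom c i ne))

sum≤0 : (c : Config (suc k)) → Vec.sum c ℕ.≤ 0 → SomeEmpty c
sum≤0 (zero ∷ c) _ = here ≡.refl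

run-stops : (τ : TieBreaking (suc k)) (past : List Draw) (c : Config (suc k)) →
            (ω : Vec Draw n) → Vec.sum c ℕ.≤ n → SomeEmpty (run τ past c ω)
run-stops τ past c []      le = sum≤0 c le
run-stops τ past c (d ∷ ω) le with someEmpty? c
... | yes e = e
... | no ¬e = run-stops τ (d ∷ past) _ ω (ℕ.s≤s⁻¹
      (≡.subst (ℕ._≤ _) (≡.sym (sum-removeFrom c i (¬e ∘ anyEmpty c i))) le))
  where i = proj₁ (τ past d c)

sum-replicate : ∀ k n → Vec.sum (replicate k n) ≡ k ℕ.* n
sum-replicate zero    n = ≡.refl
sum-replicate (suc k) n = ≡.cong (n ℕ.+_) (sum-replicate k n)

stops : ∀ k n (τ : TieBreaking (suc k)) ω → SomeEmpty (finalConfig (suc k) n τ ω)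
stops k n τ ω = run-stops τ [] _ ω (ℕ.≤-reflexive (sum-replicate (suc k) n))

allDraws : (n : ℕ) → List (Vec Draw n)
allDraws zero    = [] ∷ []
allDraws (suc n) = List.map (largest ∷_) (allDraws n) ++ List.map (smallest ∷_) (allDraws n)

module Over {c ℓ₁ ℓ₂ : Level} (F : OrderedField c ℓ₁ ℓ₂) where

  open OrderedField F hiding (zero)
  open import Algebra.Definitions.RawMonoid +-rawMonoid using (sum; _×_)
  open import Algebra.Properties.Semiring.Exp semiring using (_^_) public
  open import Algebra.Properties.Ring ring using (-0#≈0#)
  open import Algebra.Properties.Monoid.Sum +-monoid using (sum-cong-≋)
  open import Relation.Binary.Reasoning.Setoid setoid

  fromℕ : ℕ → Carrier
  fromℕ m = m × 1#

  -- #⇒invertible yields an inverse of x - 0#.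
  inv : ∀ {x} → 0# < x → Carrier
  inv 0<x = proj₁ (#⇒invertible (#-sym (<⇒# 0<x)))

  x*inv≈1 : ∀ {x} (0<x : 0# < x) → x * inv 0<x ≈ 1#
  x*inv≈1 {x} 0<x = begin
    x * inv 0<x         ≈⟨ *-congʳ x-0≈x ⟨
    (x - 0#) * inv 0<x  ≈⟨ proj₂ (proj₂ (#⇒invertible (#-sym (<⇒# 0<x)))) ⟩
    1#                  ∎
    where
    x-0≈x : x - 0# ≈ x
    x-0≈x = trans (+-congˡ -0#≈0#) (+-identityʳ x)

  0<y-x : ∀ {x y} → x < y → 0# < y - x
  0<y-x {x} {y} x<y =
    StrictOrder.<-respˡ-≈ (-‿inverseˡ x)
      (StrictOrder.<-respʳ-≈ (+-comm (- x) y) (+-monoʳ-< (- x) x<y))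

  0<fromℕ : ∀ {m} → 1 ℕ.≤ m → 0# < fromℕ m
  0<fromℕ {suc zero}    _ = StrictOrder.<-respʳ-≈ (sym (+-identityʳ 1#)) 0<1
  0<fromℕ {suc (suc m)} _ = StrictOrder.trans 0<1
    (StrictOrder.<-respˡ-≈ (+-identityʳ 1#) (+-monoʳ-< 1# (0<fromℕ {suc m} (s≤s z≤n))))

  Series : Set c
  Series = ℕ → Carrier

  infix  4 _≋_
  infixl 6 _⊕_ _⊝_
  infixl 7 _⊛_ _⊘_

  _≋_ : Series → Series → Set ℓ₁
  f ≋ g = ∀ n → f n ≈ g n

  _⊕_ _⊝_ _⊛_ : Series → Series → Series
  (f ⊕ g) n = f n + g n
  (f ⊝ g) n = f n - g n
  (f ⊛ g) n = sum {suc n} λ i → f (toℕ i) * g (n ℕ.∸ toℕ i)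

  const : Carrier → Series
  const a zero    = a
  const a (suc _) = 0#

  𝟙 Z : Series
  𝟙 = const 1#
  Z zero          = 0#
  Z (suc zero)    = 1#
  Z (suc (suc _)) = 0#

  -- f ⟨ a Z⟩ is f(az).
  _⟨_Z⟩ : Series → Carrier → Series
  (f ⟨ a Z⟩) n = a ^ n * f n

  -- recipCoeffs g n lists the coefficients n , n-1 , … , 0 of 1 / g.
  recipCoeffs : Series → (n : ℕ) → Vector Carrier (suc n)
  recipCoeffs g zero    = λ _ → 1#
  recipCoeffs g (suc n) =
    (- sum (λ i → g (suc (toℕ i)) * recipCoeffs g n i)) Vector.∷ recipCoeffs g n

  -- The inverse of a series with constant term 1 (see recip-inverse);
  -- meaningless for other constant terms.
  recip : Series → Series
  recip g n = recipCoeffs g n zero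

  _⊘_ : Series → Series → Series
  f ⊘ g = f ⊛ recip g

  recipCoeffs-lookup : ∀ g n i → recipCoeffs g n i ≡ recip g (n ℕ.∸ toℕ i)
  recipCoeffs-lookup g zero    zero    = ≡.refl
  recipCoeffs-lookup g (suc n) zero    = ≡.refl
  recipCoeffs-lookup g (suc n) (suc i) = recipCoeffs-lookup g n i

  recip-inverse : ∀ g → g 0 ≈ 1# → g ⊛ recip g ≋ 𝟙
  recip-inverse g g₀ zero    = trans (+-identityʳ _) (trans (*-identityʳ _) g₀)
  recip-inverse g g₀ (suc n) = begin
    g 0 * (- T) + sum {suc n} (λ i → g (suc (toℕ i)) * recip g (n ℕ.∸ toℕ i))
      ≈⟨ +-cong (trans (*-congʳ g₀) (*-identityˡ _)) (sum-cong-≋ {suc n} λ i →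
           *-congˡ {g (suc (toℕ i))} (sym (reflexive (recipCoeffs-lookup g n i)))) ⟩
    - T + T  ≈⟨ -‿inverseˡ T ⟩
    0#       ∎
    where
    T : Carrier
    T = sum (λ i → g (suc (toℕ i)) * recipCoeffs g n i)

  1≤ki-1 : ∀ {k i} → 2 ℕ.≤ k → 1 ℕ.≤ i → 1 ℕ.≤ k ℕ.* i ℕ.∸ 1
  1≤ki-1 2≤k 1≤i = ℕ.∸-monoˡ-≤ 1 (ℕ.*-mono-≤ 2≤k 1≤i)

  s : (k : ℕ) → 2 ℕ.≤ k → (i : ℕ) → 1 ℕ.≤ i → Carrier
  s k 2≤k i 1≤i = fromℕ (k ℕ.∸ 1) * inv (0<fromℕ (1≤ki-1 2≤k 1≤i))
                  * fromℕ ((k ℕ.* i ℕ.∸ 1) C (i ℕ.∸ 1))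

  S : (k : ℕ) → 2 ℕ.≤ k → Series
  S k 2≤k zero    = 0#
  S k 2≤k (suc j) = s k 2≤k (suc j) (s≤s z≤n)

  drawProb : Carrier → Draw → Carrier
  drawProb p largest  = p
  drawProb p smallest = 1# - p

  prob : Carrier → Vec Draw n → Carrier
  prob p []      = 1#
  prob p (d ∷ ω) = drawProb p d * prob p ω

  𝔼 : Carrier → (n : ℕ) → (Vec Draw n → Carrier) → Carrier
  𝔼 p n X = List.foldr _+_ 0# (List.map (λ ω → prob p ω * X ω) (allDraws n))

  expectedResidue : (k n : ℕ) → TieBreaking k → Carrier → Carrier
  expectedResidue k n τ p = 𝔼 p (k ℕ.* n) (λ ω → fromℕ (residue (finalConfig k n τ ω)))

  -- Each n may come with its own way of breaking ties.
  M : (k : ℕ) → (ℕ → TieBreaking k) → Carrier → Series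
  M k τ p zero    = 0#
  M k τ p (suc n) = expectedResidue k (suc n) (τ (suc n)) p

-- A reachable configuration is described by the number m of matches in a smallest box and
-- the excess d of the total over k m, since the other boxes differ by at most one. With
-- a = k - 1, d performs a walk with steps -1 (probability p) and +a (probability q), forced
-- upwards at 0, where m drops by one at each step upwards, and the residue is d when m = 0.
-- Off 0 the function d + m (k - 1/q) is harmonic, and each visit to 0 adds p/q, so the
-- expected residue is n (k - 1/q) + (p/q) V(n), where V(n) is the expected number of visits
-- to 0. Splitting the walk at its first return to 0 gives V = z/(1-z) + W V with
-- W(z) = S(p^a q z)/q, because s_i counts the paths from a to 0 with i - 1 steps upwards.

module Submission where

open import Defs
open import Algebra.Bundles using (CommutativeRing)
import Algebra.Construct.Pointwise as Pointwise
open import Data.Nat.Base as ℕ using (ℕ; zero; suc)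
import Data.Nat.Properties as ℕ
open import Data.Nat.Combinatorics using (_C_; nCk+nC[k+1]≡[n+1]C[k+1])
open import Data.Nat.Tactic.RingSolver using (solve-∀)
open import Data.Fin.Base using (Fin; zero; suc; toℕ)
open import Data.Fin.Properties using (_≟_)
open import Data.List.Base as List using (List; []; _∷_; _++_)
open import Data.Vec.Base as Vec using (Vec; []; _∷_; lookup; replicate)
open import Data.Vec.Properties using (lookup∘updateAt; lookup∘updateAt′; lookup-replicate)
open import Data.Vec.Relation.Unary.Any using (here; there)
open import Data.Product.Base using (∃; _,_; proj₁; proj₂)
open import Function.Base using (_∘_)
open import Relation.Binary.PropositionalEquality as ≡ using (_≡_; _≢_)
import Relation.Binary.Reasoning.Setoid as SetoidReasoning
open import Relation.Nullary using (¬_; yes; no; contradiction)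

-- Binomial coefficients and the ballot formula for path counts.

-- Absorption: Pascal's rule splits `suc (suc n) C suc (suc k)`, one copy of `suc n C suc k` is set
-- aside, and the rest is the induction hypothesis at `k` and at `suc k`.
[1+k]*[1+n]C[1+k]≡[1+n]*nCk : ∀ n k → suc k ℕ.* (suc n C suc k) ≡ suc n ℕ.* (n C k)
[1+k]*[1+n]C[1+k]≡[1+n]*nCk zero    zero    = ≡.refl
[1+k]*[1+n]C[1+k]≡[1+n]*nCk zero    (suc k) = ℕ.*-zeroʳ (suc (suc k))
[1+k]*[1+n]C[1+k]≡[1+n]*nCk (suc n) zero    = begin
  1 ℕ.* (suc (suc n) C 1)         ≡⟨ ≡.cong (1 ℕ.*_) (nCk+nC[k+1]≡[n+1]C[k+1] (suc n) 0) ⟨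
  1 ℕ.* (1 ℕ.+ (suc n C 1))       ≡⟨ ≡.cong (λ x → 1 ℕ.* suc x) (ℕ.*-identityˡ (suc n C 1)) ⟨
  1 ℕ.* suc (1 ℕ.* (suc n C 1))   ≡⟨ ≡.cong (λ x → 1 ℕ.* suc x) ([1+k]*[1+n]C[1+k]≡[1+n]*nCk n 0) ⟩
  1 ℕ.* suc (suc n ℕ.* 1)         ≡⟨ rearrange n ⟩
  suc (suc n) ℕ.* 1               ∎
  where
  open ≡.≡-Reasoning
  rearrange : ∀ n → 1 ℕ.* suc (suc n ℕ.* 1) ≡ suc (suc n) ℕ.* 1
  rearrange = solve-∀
[1+k]*[1+n]C[1+k]≡[1+n]*nCk (suc n) (suc k) = begin
  suc (suc k) ℕ.* (suc (suc n) C suc (suc k))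
    ≡⟨ ≡.cong (suc (suc k) ℕ.*_) (nCk+nC[k+1]≡[n+1]C[k+1] (suc n) (suc k)) ⟨
  suc (suc k) ℕ.* (A ℕ.+ (suc n C suc (suc k)))
    ≡⟨ expand k A (suc n C suc (suc k)) ⟩
  A ℕ.+ suc k ℕ.* A ℕ.+ suc (suc k) ℕ.* (suc n C suc (suc k))
    ≡⟨ ≡.cong₂ (λ x y → A ℕ.+ x ℕ.+ y) ([1+k]*[1+n]C[1+k]≡[1+n]*nCk n k)
         ([1+k]*[1+n]C[1+k]≡[1+n]*nCk n (suc k)) ⟩
  A ℕ.+ suc n ℕ.* (n C k) ℕ.+ suc n ℕ.* (n C suc k)
    ≡⟨ collect n A (n C k) (n C suc k) ⟩
  A ℕ.+ suc n ℕ.* ((n C k) ℕ.+ (n C suc k))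
    ≡⟨ ≡.cong (λ x → A ℕ.+ suc n ℕ.* x) (nCk+nC[k+1]≡[n+1]C[k+1] n k) ⟩
  suc (suc n) ℕ.* A ∎
  where
  open ≡.≡-Reasoning
  A = suc n C suc k
  expand : ∀ k A B → suc (suc k) ℕ.* (A ℕ.+ B) ≡ A ℕ.+ suc k ℕ.* A ℕ.+ suc (suc k) ℕ.* B
  expand = solve-∀
  collect : ∀ n A B C → A ℕ.+ suc n ℕ.* B ℕ.+ suc n ℕ.* C ≡ A ℕ.+ suc n ℕ.* (B ℕ.+ C)
  collect = solve-∀

-- N(d,j), the number of paths from d which first reach 0 at their end, with steps -1 and
-- exactly j steps +a.
pathCount : (a d j : ℕ) → ℕ
pathCount a d       zero    = 1
pathCount a zero    (suc j) = 0
pathCount a (suc d) (suc j) = pathCount a d (suc j) ℕ.+ pathCount a (suc d ℕ.+ a) j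

-- This is N(d,i) = C(x+1,i) - k C(x,i-1) for i = j + 1, k = a + 1 and x + 1 = d + k i, moved
-- so that no subtraction occurs; by Pascal's rule that difference has the recurrence of N.
pathCount-complement : ∀ a d j → let x = d ℕ.+ (j ℕ.+ a ℕ.* suc j) in
                       pathCount a d (suc j) ℕ.+ suc a ℕ.* (x C j) ≡ suc x C suc j
-- A path from 0 has no steps, so the first summand is 0; as `suc x` is k (j + 1) here, absorption
-- remains.
pathCount-complement a zero j = ℕ.*-cancelˡ-≡ _ _ (suc j) (begin
  suc j ℕ.* (suc a ℕ.* B)             ≡⟨ rearrange a j B ⟩
  suc (j ℕ.+ a ℕ.* suc j) ℕ.* B       ≡⟨ [1+k]*[1+n]C[1+k]≡[1+n]*nCk (j ℕ.+ a ℕ.* suc j) j ⟨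
  suc j ℕ.* (suc (j ℕ.+ a ℕ.* suc j) C suc j) ∎)
  where
  open ≡.≡-Reasoning
  B = (j ℕ.+ a ℕ.* suc j) C j
  rearrange : ∀ a j B → suc j ℕ.* (suc a ℕ.* B) ≡ suc (j ℕ.+ a ℕ.* suc j) ℕ.* B
  rearrange = solve-∀
pathCount-complement a (suc d) zero = begin
  pathCount a d 1 ℕ.+ 1 ℕ.+ suc a ℕ.* 1    ≡⟨ rearrange a (pathCount a d 1) ⟩
  1 ℕ.+ (pathCount a d 1 ℕ.+ suc a ℕ.* 1)  ≡⟨ ≡.cong suc (pathCount-complement a d 0) ⟩
  1 ℕ.+ (suc x C 1)                        ≡⟨ nCk+nC[k+1]≡[n+1]C[k+1] (suc x) 0 ⟩
  suc (suc x) C 1                          ∎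
  where
  open ≡.≡-Reasoning
  x = d ℕ.+ (0 ℕ.+ a ℕ.* 1)
  rearrange : ∀ a P → P ℕ.+ 1 ℕ.+ suc a ℕ.* 1 ≡ 1 ℕ.+ (P ℕ.+ suc a ℕ.* 1)
  rearrange = solve-∀
pathCount-complement a (suc d) (suc j) = begin
  P ℕ.+ Q ℕ.+ suc a ℕ.* (suc x C suc j)
    ≡⟨ ≡.cong (λ B → P ℕ.+ Q ℕ.+ suc a ℕ.* B) (nCk+nC[k+1]≡[n+1]C[k+1] x j) ⟨
  P ℕ.+ Q ℕ.+ suc a ℕ.* ((x C j) ℕ.+ (x C suc j))
    -- `P` counts the paths whose first step is -1, `Q` those whose first step is +a. The latter
    -- start higher by k than the former and have one step upwards fewer left, so both have the same
    -- `x`.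
    ≡⟨ regroup a P Q (x C j) (x C suc j) ⟩
  (Q ℕ.+ suc a ℕ.* (x C j)) ℕ.+ (P ℕ.+ suc a ℕ.* (x C suc j))
    ≡⟨ ≡.cong₂ ℕ._+_
         (≡.subst (λ y → Q ℕ.+ suc a ℕ.* (y C j) ≡ suc y C suc j) (shift a d j)
           (pathCount-complement a (suc d ℕ.+ a) j))
         (pathCount-complement a d (suc j)) ⟩
  (suc x C suc j) ℕ.+ (suc x C suc (suc j))
    ≡⟨ nCk+nC[k+1]≡[n+1]C[k+1] (suc x) (suc j) ⟩
  suc (suc x) C suc (suc j) ∎
  where
  open ≡.≡-Reasoning
  x = d ℕ.+ (suc j ℕ.+ a ℕ.* suc (suc j))
  P = pathCount a d (suc (suc j))
  Q = pathCount a (suc d ℕ.+ a) (suc j)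
  regroup : ∀ a P Q A B → P ℕ.+ Q ℕ.+ suc a ℕ.* (A ℕ.+ B) ≡
            (Q ℕ.+ suc a ℕ.* A) ℕ.+ (P ℕ.+ suc a ℕ.* B)
  regroup = solve-∀
  shift : ∀ a d j → suc d ℕ.+ a ℕ.+ (j ℕ.+ a ℕ.* suc j) ≡ d ℕ.+ (suc j ℕ.+ a ℕ.* suc (suc j))
  shift = solve-∀

-- The ballot formula N(d,j) = (d/x) C(x,j), cleared of its denominator. Multiply
-- `pathCount-complement` by `x`: absorption turns k x C(x-1,j-1) into k j C(x,j), and x - k j = d.
pathCount-ballot : ∀ a d j → let x = d ℕ.+ suc a ℕ.* j in
                   x ℕ.* pathCount a d j ≡ d ℕ.* (x C j)
pathCount-ballot a d zero = begin
  (d ℕ.+ suc a ℕ.* 0) ℕ.* 1  ≡⟨ ≡.cong (λ x → (d ℕ.+ x) ℕ.* 1) (ℕ.*-zeroʳ (suc a)) ⟩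
  (d ℕ.+ 0) ℕ.* 1            ≡⟨ ≡.cong (ℕ._* 1) (ℕ.+-identityʳ d) ⟩
  d ℕ.* 1                    ∎
  where open ≡.≡-Reasoning
pathCount-ballot a d (suc j) = ℕ.+-cancelʳ-≡ (suc a ℕ.* (suc j ℕ.* B)) _ _ (begin
  x ℕ.* N ℕ.+ suc a ℕ.* (suc j ℕ.* B)        ≡⟨ ≡.cong (λ t → x ℕ.* N ℕ.+ suc a ℕ.* t) absorb ⟩
  x ℕ.* N ℕ.+ suc a ℕ.* (x ℕ.* (y C j))      ≡⟨ collect a x N (y C j) ⟩
  x ℕ.* (N ℕ.+ suc a ℕ.* (y C j))            ≡⟨ ≡.cong (x ℕ.*_) (pathCount-complement a d j) ⟩
  x ℕ.* (suc y C suc j)                      ≡⟨ ≡.cong (λ t → x ℕ.* (t C suc j)) x≡1+y ⟨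
  x ℕ.* B                                    ≡⟨ expand a d j B ⟩
  d ℕ.* B ℕ.+ suc a ℕ.* (suc j ℕ.* B)        ∎)
  where
  open ≡.≡-Reasoning
  x = d ℕ.+ suc a ℕ.* suc j
  y = d ℕ.+ (j ℕ.+ a ℕ.* suc j)
  B = x C suc j
  N = pathCount a d (suc j)
  x≡1+y : x ≡ suc y
  x≡1+y = ℕ.+-suc d _
  absorb : suc j ℕ.* B ≡ x ℕ.* (y C j)
  absorb = ≡.subst (λ t → suc j ℕ.* (t C suc j) ≡ t ℕ.* (y C j)) (≡.sym x≡1+y)
    ([1+k]*[1+n]C[1+k]≡[1+n]*nCk y j)
  collect : ∀ a x N C → x ℕ.* N ℕ.+ suc a ℕ.* (x ℕ.* C) ≡ x ℕ.* (N ℕ.+ suc a ℕ.* C)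
  collect = solve-∀
  expand : ∀ a d j B → (d ℕ.+ suc a ℕ.* suc j) ℕ.* B ≡ d ℕ.* B ℕ.+ suc a ℕ.* (suc j ℕ.* B)
  expand = solve-∀

-- Balanced configurations under the two kinds of draw.

private
  variable
    k n m d : ℕ
    c : Config k
    i j : Fin k

-- The shape of every reachable configuration.
record Balanced (c : Config k) (i : Fin k) (m d : ℕ) : Set where
  constructor balanced
  field
    bottom  : lookup c i ≡ m
    minimal : IsChoice smallest c i
    level   : ∀ {j l} → j ≢ i → l ≢ i → lookup c j ℕ.≤ suc (lookup c l)
    total   : Vec.sum c ≡ d ℕ.+ k ℕ.* m

open Balanced

balanced-replicate : ∀ n (i : Fin k) → Balanced (replicate k n) i n 0
balanced-replicate {k} n i = balanced (lookup-replicate i n)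
  (λ j → ℕ.≤-reflexive (≡.trans (lookup-replicate i n) (≡.sym (lookup-replicate j n))))
  (λ {j} {l} _ _ → ℕ.m≤n⇒m≤1+n
    (ℕ.≤-reflexive (≡.trans (lookup-replicate j n) (≡.sym (lookup-replicate l n)))))
  (sum-replicate k n)

-- A tie may be broken towards a box other than `i`. Such a `j` holds the minimum and was subject to
-- `level`, so every box is within one of the minimum.
recentre : IsChoice smallest c j → Balanced c i m d → Balanced c j m d
recentre {c = c} {j = j} {i = i} min b with i ≟ j
... | yes ≡.refl = b
... | no  i≢j    = balanced (≡.trans c[j]≡c[i] (bottom b)) min
    (λ {l} {l′} _ l′≢j → lev l l′) (total b)
  where
  c[j]≡c[i] : lookup c j ≡ lookup c i
  c[j]≡c[i] = ℕ.≤-antisym (min i) (minimal b j)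
  lev : ∀ l l′ → lookup c l ℕ.≤ suc (lookup c l′)
  lev l l′ with l ≟ i
  ... | yes ≡.refl = ℕ.m≤n⇒m≤1+n (minimal b l′)
  ... | no  l≢i    = ℕ.≤-trans (level b l≢i (i≢j ∘ ≡.sym)) (ℕ.s≤s (min l′))

lookup-removeFrom : ∀ (c : Config k) i → lookup (removeFrom c i) i ≡ ℕ.pred (lookup c i)
lookup-removeFrom c i = lookup∘updateAt i c

lookup-removeFrom-≢ : ∀ (c : Config k) {i j} → i ≢ j → lookup (removeFrom c j) i ≡ lookup c i
lookup-removeFrom-≢ c {i} {j} i≢j = lookup∘updateAt′ i j i≢j c

removeFrom-≤ : ∀ (c : Config k) i j → lookup (removeFrom c i) j ℕ.≤ lookup c j
removeFrom-≤ c i j with j ≟ i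
... | yes ≡.refl = ≡.subst (ℕ._≤ lookup c i) (≡.sym (lookup-removeFrom c i)) ℕ.pred[n]≤n
... | no  j≢i    = ℕ.≤-reflexive (lookup-removeFrom-≢ c j≢i)

-- The total loses one match and k m loses k, so the excess gains k - 1 = a. `level` does not
-- concern box `i`.
removeFrom-smallest : ∀ {a} {c : Config (suc a)} {i} → Balanced c i (suc m) d →
                      Balanced (removeFrom c i) i m (d ℕ.+ a)
removeFrom-smallest {m = m} {d = d} {a = a} {c = c} {i = i} b =
  balanced bot min lev (ℕ.suc-injective (begin
    suc (Vec.sum (removeFrom c i))   ≡⟨ sum-removeFrom c i c[i]≢0 ⟩
    Vec.sum c                        ≡⟨ total b ⟩
    d ℕ.+ suc a ℕ.* suc m            ≡⟨ rearrange a d m ⟩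
    suc (d ℕ.+ a ℕ.+ suc a ℕ.* m)    ∎))
  where
  open ≡.≡-Reasoning
  c[i]≢0 : lookup c i ≢ 0
  c[i]≢0 eq = ℕ.1+n≢0 (≡.trans (≡.sym (bottom b)) eq)
  bot : lookup (removeFrom c i) i ≡ m
  bot = ≡.trans (lookup-removeFrom c i) (≡.cong ℕ.pred (bottom b))
  min : IsChoice smallest (removeFrom c i) i
  min j with j ≟ i
  ... | yes ≡.refl = ℕ.≤-refl
  ... | no  j≢i    = ≡.subst (lookup (removeFrom c i) i ℕ.≤_) (≡.sym (lookup-removeFrom-≢ c j≢i))
    (ℕ.≤-trans (removeFrom-≤ c i i) (minimal b j))
  lev : ∀ {j l} → j ≢ i → l ≢ i → lookup (removeFrom c i) j ℕ.≤ suc (lookup (removeFrom c i) l)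
  lev j≢i l≢i = ≡.subst₂ (λ x y → x ℕ.≤ suc y)
    (≡.sym (lookup-removeFrom-≢ c j≢i)) (≡.sym (lookup-removeFrom-≢ c l≢i)) (level b j≢i l≢i)
  rearrange : ∀ a d m → d ℕ.+ suc a ℕ.* suc m ≡ suc (d ℕ.+ a ℕ.+ suc a ℕ.* m)
  rearrange = solve-∀

sum-≤ : ∀ (c : Config k) → (∀ j → lookup c j ℕ.≤ m) → Vec.sum c ℕ.≤ k ℕ.* m
sum-≤ []      le = ℕ.z≤n
sum-≤ (x ∷ c) le = ℕ.+-mono-≤ (le zero) (sum-≤ c (le ∘ suc))

sum-≥ : ∀ (c : Config k) → (∀ j → m ℕ.≤ lookup c j) → k ℕ.* m ℕ.≤ Vec.sum c
sum-≥ []      ge = ℕ.z≤n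
sum-≥ (x ∷ c) ge = ℕ.+-mono-≤ (ge zero) (sum-≥ c (ge ∘ suc))

-- The boxes other than `j` hold at least `m` each; the extra `m` on both sides avoids the
-- subtraction in k - 1.
lookup+k*m≤sum+m : ∀ (c : Config k) → (∀ j → m ℕ.≤ lookup c j) →
                   ∀ j → lookup c j ℕ.+ k ℕ.* m ℕ.≤ Vec.sum c ℕ.+ m
lookup+k*m≤sum+m {suc k} {m} (x ∷ c) ge zero = begin
  x ℕ.+ (m ℕ.+ k ℕ.* m)    ≡⟨ rearrange x m (k ℕ.* m) ⟩
  x ℕ.+ k ℕ.* m ℕ.+ m      ≤⟨ ℕ.+-monoˡ-≤ m (ℕ.+-monoʳ-≤ x (sum-≥ c (ge ∘ suc))) ⟩
  x ℕ.+ Vec.sum c ℕ.+ m    ∎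
  where
  open ℕ.≤-Reasoning
  rearrange : ∀ x m t → x ℕ.+ (m ℕ.+ t) ≡ x ℕ.+ t ℕ.+ m
  rearrange = solve-∀
lookup+k*m≤sum+m {suc k} {m} (x ∷ c) ge (suc j) = begin
  lookup c j ℕ.+ (m ℕ.+ k ℕ.* m)  ≡⟨ rearrange (lookup c j) m (k ℕ.* m) ⟩
  m ℕ.+ (lookup c j ℕ.+ k ℕ.* m)  ≤⟨ ℕ.+-mono-≤ (ge zero) (lookup+k*m≤sum+m c (ge ∘ suc) j) ⟩
  x ℕ.+ (Vec.sum c ℕ.+ m)         ≡⟨ ℕ.+-assoc x (Vec.sum c) m ⟨
  x ℕ.+ Vec.sum c ℕ.+ m           ∎
  where
  open ℕ.≤-Reasoning
  rearrange : ∀ y m t → y ℕ.+ (m ℕ.+ t) ≡ m ℕ.+ (y ℕ.+ t)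
  rearrange = solve-∀

-- Without excess no box holds more than `m`, so even a draw from a largest box hits a smallest one.
-- This is the forced step upwards at 0.
smallest-of-level : Balanced c i m 0 → ∀ j → IsChoice smallest c j
smallest-of-level {k} {c = c} {i = i} {m = m} b j l = begin
  lookup c j  ≤⟨ ℕ.+-cancelʳ-≤ (k ℕ.* m) (lookup c j) m (≡.subst (lookup c j ℕ.+ k ℕ.* m ℕ.≤_)
                  (≡.trans (≡.cong (ℕ._+ m) (total b)) (ℕ.+-comm (k ℕ.* m) m))
                  (lookup+k*m≤sum+m c (λ l → ≡.subst (ℕ._≤ lookup c l) (bottom b) (minimal b l)) j)) ⟩
  m           ≡⟨ bottom b ⟨
  lookup c i  ≤⟨ minimal b l ⟩
  lookup c l  ∎
  where open ℕ.≤-Reasoning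

-- If a largest box held at most `m`, the total would be at most k m, leaving no excess.
largest>m : Balanced c i m (suc d) → IsChoice largest c j → m ℕ.< lookup c j
largest>m {c = c} {i = i} {m = m} {d = d} {j = j} b max = ℕ.≰⇒> λ c[j]≤m →
  ℕ.<⇒≱ (ℕ.m≤n+m (suc _) d) (≡.subst (ℕ._≤ _) (≡.trans (total b) (≡.sym (ℕ.+-suc d _)))
    (sum-≤ c λ l → ℕ.≤-trans (max l) c[j]≤m))

-- The drawn box differs from `i`, since it holds more than `m`. Being largest, it is after its loss
-- still at most one below any other box.
removeFrom-largest : Balanced c i m (suc d) → IsChoice largest c j → Balanced (removeFrom c j) i m d
removeFrom-largest {k} {c} {i} {m} {d} {j} b max =
  balanced bot min lev (ℕ.suc-injective (≡.trans (sum-removeFrom c j c[j]≢0) (total b)))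
  where
  m<c[j] : m ℕ.< lookup c j
  m<c[j] = largest>m b max
  c[j]≢0 : lookup c j ≢ 0
  c[j]≢0 = ℕ.m<n⇒n≢0 m<c[j]
  suc-pred : suc (lookup (removeFrom c j) j) ≡ lookup c j
  suc-pred = ≡.trans (≡.cong suc (lookup-removeFrom c j))
    (ℕ.suc-pred (lookup c j) {{ℕ.≢-nonZero c[j]≢0}})
  i≢j : i ≢ j
  i≢j ≡.refl = ℕ.<-irrefl (≡.sym (bottom b)) m<c[j]
  bot : lookup (removeFrom c j) i ≡ m
  bot = ≡.trans (lookup-removeFrom-≢ c i≢j) (bottom b)
  min : IsChoice smallest (removeFrom c j) i
  min l with l ≟ j
  ... | yes ≡.refl = ≡.subst (ℕ._≤ lookup (removeFrom c j) j) (≡.sym bot)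
    (ℕ.s≤s⁻¹ (≡.subst (suc m ℕ.≤_) (≡.sym suc-pred) m<c[j]))
  ... | no  l≢j    = ≡.subst₂ ℕ._≤_ (≡.sym (lookup-removeFrom-≢ c i≢j))
    (≡.sym (lookup-removeFrom-≢ c l≢j)) (minimal b l)
  lev : ∀ {l l′} → l ≢ i → l′ ≢ i →
        lookup (removeFrom c j) l ℕ.≤ suc (lookup (removeFrom c j) l′)
  lev {l} {l′} l≢i l′≢i with l′ ≟ j
  ... | yes ≡.refl = ≡.subst (lookup (removeFrom c j) l ℕ.≤_) (≡.sym suc-pred)
    (ℕ.≤-trans (removeFrom-≤ c j l) (max l))
  ... | no  l′≢j   = ≡.subst (λ x → lookup (removeFrom c j) l ℕ.≤ suc x)
    (≡.sym (lookup-removeFrom-≢ c l′≢j))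
    (ℕ.≤-trans (removeFrom-≤ c j l) (level b l≢i l′≢i))

SomeEmpty⇒∃lookup≡0 : SomeEmpty c → ∃ λ j → lookup c j ≡ 0
SomeEmpty⇒∃lookup≡0 (here eq) = zero , eq
SomeEmpty⇒∃lookup≡0 (there e) with SomeEmpty⇒∃lookup≡0 e
... | j , eq = suc j , eq

balanced-nonempty : Balanced c i (suc m) d → ¬ SomeEmpty c
balanced-nonempty b e with SomeEmpty⇒∃lookup≡0 e
... | j , eq = ℕ.n≮0 (≡.subst₂ ℕ._≤_ (bottom b) eq (minimal b j))

run-empty : (τ : TieBreaking k) (past : List Draw) (ω : Vec Draw n) →
            SomeEmpty c → run τ past c ω ≡ c
run-empty         τ past []      e = ≡.refl
run-empty {c = c} τ past (d ∷ ω) e with someEmpty? c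
... | yes _ = ≡.refl
... | no ¬e = contradiction e ¬e

run-nonempty : (τ : TieBreaking k) (past : List Draw) (δ : Draw) (ω : Vec Draw n) → ¬ SomeEmpty c →
               run τ past c (δ ∷ ω) ≡ run τ (δ ∷ past) (removeFrom c (proj₁ (τ past δ c))) ω
run-nonempty {c = c} τ past δ ω ¬e with someEmpty? c
... | yes e = contradiction e ¬e
... | no  _ = ≡.refl

module _ {c ℓ₁ ℓ₂} (F : OrderedField c ℓ₁ ℓ₂) where

  open OrderedField F hiding (zero; semiring; ring; +-monoid)
  open Over F
  open CommutativeRing commutativeRing
    using (commutativeSemiring; semiring; ring; +-monoid; +-group)
  open import Algebra.Properties.Group +-group
    using (//-rightDividesˡ; //-rightDividesʳ) renaming (∙-cancelʳ to +-cancelʳ)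
  open import Algebra.Properties.Semiring.Mult semiring using (×-homo-+; ×1-homo-*)
  open import Algebra.Properties.Semiring.Exp semiring using (^-homo-*)
  open import Algebra.Properties.Monoid.Sum +-monoid using (sum-cong-≋)
  open import Algebra.Solver.Ring.NaturalCoefficients.Default commutativeSemiring
    using (solve; _:=_; _:+_; _:*_; con)
  module ≈-Reasoning = SetoidReasoning setoid

  -- The commutative ring of formal power series.

  -- `(f ⊛ g) (suc n)` reduces to `f 0 * g (suc n) + (tail f ⊛ g) n`, which lets laws of the product
  -- be proved by induction on the coefficient for all `f` at once.
  tail : Series → Series
  tail f n = f (suc n)

  infixr 7 _·_
  _·_ : Carrier → Series → Series
  (x · f) n = x * f n

  ⊛-cong : ∀ {f f′ g g′} → f ≋ f′ → g ≋ g′ → f ⊛ g ≋ f′ ⊛ g′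
  ⊛-cong f≋f′ g≋g′ n = sum-cong-≋ {suc n} λ i → *-cong (f≋f′ (toℕ i)) (g≋g′ (n ℕ.∸ toℕ i))

  ·-⊛ : ∀ x f g → (x · f) ⊛ g ≋ x · (f ⊛ g)
  ·-⊛ x f g zero =
    solve 3 (λ x a b → x :* a :* b :+ con 0 := x :* (a :* b :+ con 0)) refl x (f 0) (g 0)
  ·-⊛ x f g (suc n) = begin
    x * f 0 * g (suc n) + ((x · tail f) ⊛ g) n    ≈⟨ +-congˡ (·-⊛ x (tail f) g n) ⟩
    x * f 0 * g (suc n) + x * (tail f ⊛ g) n      ≈⟨ solve 4 (λ x a b r →
                                                       x :* a :* b :+ x :* r := x :* (a :* b :+ r)) refl
                                                       x (f 0) (g (suc n)) ((tail f ⊛ g) n) ⟩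
    x * (f 0 * g (suc n) + (tail f ⊛ g) n)        ∎
    where open ≈-Reasoning

  ⊛-distribʳ : ∀ h f g → (f ⊕ g) ⊛ h ≋ f ⊛ h ⊕ g ⊛ h
  ⊛-distribʳ h f g zero =
    solve 3 (λ a b c → (a :+ b) :* c :+ con 0 := a :* c :+ con 0 :+ (b :* c :+ con 0)) refl
      (f 0) (g 0) (h 0)
  ⊛-distribʳ h f g (suc n) = begin
    (f 0 + g 0) * h (suc n) + ((tail f ⊕ tail g) ⊛ h) n
      ≈⟨ +-congˡ (⊛-distribʳ h (tail f) (tail g) n) ⟩
    (f 0 + g 0) * h (suc n) + ((tail f ⊛ h) n + (tail g ⊛ h) n)
      ≈⟨ solve 5 (λ a b c r s → (a :+ b) :* c :+ (r :+ s) := (a :* c :+ r) :+ (b :* c :+ s)) refl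
           (f 0) (g 0) (h (suc n)) ((tail f ⊛ h) n) ((tail g ⊛ h) n) ⟩
    f 0 * h (suc n) + (tail f ⊛ h) n + (g 0 * h (suc n) + (tail g ⊛ h) n) ∎
    where open ≈-Reasoning

  -- The product unfolds by splitting off the term with `f 0`; splitting off the term with `g 0`
  -- instead is what commutativity needs.
  ⊛-sucʳ : ∀ f g n → (f ⊛ g) (suc n) ≈ f (suc n) * g 0 + (f ⊛ tail g) n
  ⊛-sucʳ f g zero    =
    solve 4 (λ a b c d → a :* b :+ (c :* d :+ con 0) := c :* d :+ (a :* b :+ con 0)) refl
      (f 0) (g 1) (f 1) (g 0)
  ⊛-sucʳ f g (suc n) = begin
    f 0 * g (suc (suc n)) + (tail f ⊛ g) (suc n)
      ≈⟨ +-congˡ (⊛-sucʳ (tail f) g n) ⟩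
    f 0 * g (suc (suc n)) + (f (suc (suc n)) * g 0 + (tail f ⊛ tail g) n)
      ≈⟨ solve 3 (λ x y z → x :+ (y :+ z) := y :+ (x :+ z)) refl
           (f 0 * g (suc (suc n))) (f (suc (suc n)) * g 0) ((tail f ⊛ tail g) n) ⟩
    f (suc (suc n)) * g 0 + (f ⊛ tail g) (suc n) ∎
    where open ≈-Reasoning

  ⊛-comm : ∀ f g → f ⊛ g ≋ g ⊛ f
  ⊛-comm f g zero    = +-congʳ (*-comm (f 0) (g 0))
  ⊛-comm f g (suc n) = begin
    f 0 * g (suc n) + (tail f ⊛ g) n   ≈⟨ +-cong (*-comm (f 0) (g (suc n))) (⊛-comm (tail f) g n) ⟩
    g (suc n) * f 0 + (g ⊛ tail f) n   ≈⟨ ⊛-sucʳ g f n ⟨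
    (g ⊛ f) (suc n)                    ∎
    where open ≈-Reasoning

  ⊛-distribˡ : ∀ h f g → h ⊛ (f ⊕ g) ≋ h ⊛ f ⊕ h ⊛ g
  ⊛-distribˡ h f g n = begin
    (h ⊛ (f ⊕ g)) n         ≈⟨ ⊛-comm h (f ⊕ g) n ⟩
    ((f ⊕ g) ⊛ h) n         ≈⟨ ⊛-distribʳ h f g n ⟩
    (f ⊛ h) n + (g ⊛ h) n   ≈⟨ +-cong (⊛-comm f h n) (⊛-comm g h n) ⟩
    (h ⊛ f) n + (h ⊛ g) n   ∎
    where open ≈-Reasoning

  ⊛-assoc : ∀ f g h → (f ⊛ g) ⊛ h ≋ f ⊛ (g ⊛ h)
  ⊛-assoc f g h zero    =
    solve 3 (λ a b c → (a :* b :+ con 0) :* c :+ con 0 := a :* (b :* c :+ con 0) :+ con 0) refl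
      (f 0) (g 0) (h 0)
  ⊛-assoc f g h (suc n) = begin
    -- Here `tail (f ⊛ g)` has unfolded to `f 0 · tail g ⊕ tail f ⊛ g`.
    (f 0 * g 0 + 0#) * h (suc n) + ((f 0 · tail g ⊕ tail f ⊛ g) ⊛ h) n
      ≈⟨ +-congˡ (⊛-distribʳ h (f 0 · tail g) (tail f ⊛ g) n) ⟩
    (f 0 * g 0 + 0#) * h (suc n) + (((f 0 · tail g) ⊛ h) n + ((tail f ⊛ g) ⊛ h) n)
      ≈⟨ +-congˡ (+-cong (·-⊛ (f 0) (tail g) h n) (⊛-assoc (tail f) g h n)) ⟩
    (f 0 * g 0 + 0#) * h (suc n) + (f 0 * (tail g ⊛ h) n + (tail f ⊛ (g ⊛ h)) n)
      ≈⟨ solve 5 (λ a b c r t → (a :* b :+ con 0) :* c :+ (a :* r :+ t) := a :* (b :* c :+ r) :+ t) refl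
           (f 0) (g 0) (h (suc n)) ((tail g ⊛ h) n) ((tail f ⊛ (g ⊛ h)) n) ⟩
    f 0 * (g 0 * h (suc n) + (tail g ⊛ h) n) + (tail f ⊛ (g ⊛ h)) n ∎
    where open ≈-Reasoning

  ⊛-zeroˡ : ∀ f → (λ _ → 0#) ⊛ f ≋ (λ _ → 0#)
  ⊛-zeroˡ f zero    = trans (+-identityʳ _) (zeroˡ (f 0))
  ⊛-zeroˡ f (suc n) = trans (+-cong (zeroˡ (f (suc n))) (⊛-zeroˡ f n)) (+-identityˡ 0#)

  const-⊛ : ∀ x f → const x ⊛ f ≋ x · f
  const-⊛ x f zero    = +-identityʳ _
  const-⊛ x f (suc n) = trans (+-congˡ (⊛-zeroˡ f n)) (+-identityʳ _)

  ⊛-identityˡ : ∀ f → 𝟙 ⊛ f ≋ f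
  ⊛-identityˡ f n = trans (const-⊛ 1# f n) (*-identityˡ (f n))

  seriesRing : CommutativeRing c ℓ₁
  seriesRing = record
    { Carrier = Series
    ; _≈_     = _≋_
    ; _+_     = _⊕_
    ; _*_     = _⊛_
    ; -_      = λ f n → - f n
    ; 0#      = λ _ → 0#
    ; 1#      = 𝟙
    ; isCommutativeRing = record
      { isRing = record
        { +-isAbelianGroup = Pointwise.isAbelianGroup ℕ +-isAbelianGroup
        ; *-cong     = ⊛-cong
        ; *-assoc    = ⊛-assoc
        ; *-identity = ⊛-identityˡ , λ f n → trans (⊛-comm f 𝟙 n) (⊛-identityˡ f n)
        ; distrib    = ⊛-distribˡ , ⊛-distribʳ
        }
      ; *-comm = ⊛-comm
      }
    }

  private module Series-ring = CommutativeRing seriesRing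
  open import Algebra.Properties.Ring Series-ring.ring
    using () renaming ([y-z]x≈yx-zx to ⊛-distribʳ-⊝)

  -- A series with constant term 1 is invertible. This identifies quotients by clearing their
  -- denominators.
  ⊘-unique : ∀ {f g x} → g 0 ≈ 1# → g ⊛ x ≋ f → x ≋ f ⊘ g
  ⊘-unique {f} {g} {x} g₀≈1 gx≋f = begin
    x                     ≈⟨ ⊛-identityˡ x ⟨
    𝟙 ⊛ x                 ≈⟨ ⊛-cong (recip-inverse g g₀≈1) (Series-ring.refl {x}) ⟨
    g ⊛ recip g ⊛ x       ≈⟨ ⊛-assoc g (recip g) x ⟩
    g ⊛ (recip g ⊛ x)     ≈⟨ ⊛-cong (Series-ring.refl {g}) (⊛-comm (recip g) x) ⟩
    g ⊛ (x ⊛ recip g)     ≈⟨ ⊛-assoc g x (recip g) ⟨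
    g ⊛ x ⊛ recip g       ≈⟨ ⊛-cong gx≋f (Series-ring.refl {recip g}) ⟩
    f ⊘ g                 ∎
    where open SetoidReasoning Series-ring.setoid

  -- Multiplication by z, and the series z/(1-z) and z/(1-z)^2.

  Z⊛-suc : ∀ f n → (Z ⊛ f) (suc n) ≈ f n
  Z⊛-suc f n = begin
    0# * f (suc n) + (tail Z ⊛ f) n  ≈⟨ +-cong (zeroˡ (f (suc n)))
                                          (⊛-cong tail-Z (Series-ring.refl {f}) n) ⟩
    0# + (𝟙 ⊛ f) n                   ≈⟨ +-identityˡ _ ⟩
    (𝟙 ⊛ f) n                        ≈⟨ ⊛-identityˡ f n ⟩
    f n                              ∎
    where
    open ≈-Reasoning
    tail-Z : tail Z ≋ 𝟙
    tail-Z zero    = refl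
    tail-Z (suc _) = refl

  Z⊛-zero : ∀ f → (Z ⊛ f) 0 ≈ 0#
  Z⊛-zero f = trans (+-identityʳ _) (zeroˡ (f 0))

  x-0≈x : ∀ {x y} → y ≈ 0# → x - y ≈ x
  x-0≈x {x} {y} y≈0 = begin
    x - y        ≈⟨ +-identityʳ (x - y) ⟨
    x - y + 0#   ≈⟨ +-congˡ y≈0 ⟨
    x - y + y    ≈⟨ //-rightDividesˡ y x ⟩
    x            ∎
    where open ≈-Reasoning

  [𝟙⊝Z]⊛ : ∀ f → (𝟙 ⊝ Z) ⊛ f ≋ f ⊝ Z ⊛ f
  [𝟙⊝Z]⊛ f n = trans (⊛-distribʳ-⊝ f 𝟙 Z n) (+-congʳ (⊛-identityˡ f n))

  [𝟙⊝Z]⊛-zero : ∀ f → ((𝟙 ⊝ Z) ⊛ f) 0 ≈ f 0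
  [𝟙⊝Z]⊛-zero f = trans ([𝟙⊝Z]⊛ f 0) (x-0≈x (Z⊛-zero f))

  [𝟙⊝Z]⊛-suc : ∀ f n → ((𝟙 ⊝ Z) ⊛ f) (suc n) ≈ f (suc n) - f n
  [𝟙⊝Z]⊛-suc f n = trans ([𝟙⊝Z]⊛ f (suc n)) (+-congˡ (-‿cong (Z⊛-suc f n)))

  ones : Series
  ones zero    = 0#
  ones (suc _) = 1#

  [𝟙⊝Z]⊛ones : (𝟙 ⊝ Z) ⊛ ones ≋ Z
  [𝟙⊝Z]⊛ones zero          = [𝟙⊝Z]⊛-zero ones
  [𝟙⊝Z]⊛ones (suc zero)    = trans ([𝟙⊝Z]⊛-suc ones 0) (x-0≈x refl)
  [𝟙⊝Z]⊛ones (suc (suc n)) = trans ([𝟙⊝Z]⊛-suc ones (suc n)) (-‿inverseʳ 1#)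

  -- `fromℕ` itself is read as the series with coefficients n; multiplying by 1 - z takes
  -- differences.
  [𝟙⊝Z]⊛fromℕ : (𝟙 ⊝ Z) ⊛ fromℕ ≋ ones
  [𝟙⊝Z]⊛fromℕ zero    = [𝟙⊝Z]⊛-zero fromℕ
  [𝟙⊝Z]⊛fromℕ (suc n) = trans ([𝟙⊝Z]⊛-suc fromℕ n) (//-rightDividesʳ (fromℕ n) 1#)

  ones≋ : ones ≋ Z ⊘ (𝟙 ⊝ Z)
  ones≋ = ⊘-unique (x-0≈x refl) [𝟙⊝Z]⊛ones

  fromℕ≋ : fromℕ ≋ Z ⊘ ((𝟙 ⊝ Z) ⊛ (𝟙 ⊝ Z))
  fromℕ≋ = ⊘-unique (trans ([𝟙⊝Z]⊛-zero (𝟙 ⊝ Z)) (x-0≈x refl)) (begin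
    (𝟙 ⊝ Z) ⊛ (𝟙 ⊝ Z) ⊛ fromℕ    ≈⟨ ⊛-assoc (𝟙 ⊝ Z) (𝟙 ⊝ Z) fromℕ ⟩
    (𝟙 ⊝ Z) ⊛ ((𝟙 ⊝ Z) ⊛ fromℕ)  ≈⟨ ⊛-cong (Series-ring.refl {𝟙 ⊝ Z}) [𝟙⊝Z]⊛fromℕ ⟩
    (𝟙 ⊝ Z) ⊛ ones               ≈⟨ [𝟙⊝Z]⊛ones ⟩
    Z                            ∎)
    where open SetoidReasoning Series-ring.setoid

  -- The coefficients of S as path counts.

  fromℕ-cong : ∀ {m n} → m ≡ n → fromℕ m ≈ fromℕ n
  fromℕ-cong m≡n = reflexive (≡.cong fromℕ m≡n)

  -- The ballot formula with `d = a` and j = i - 1, for which `x` is k i - 1; the inverse of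
  -- `fromℕ x` in `s` cancels.
  S≈pathCount : ∀ a (2≤k : 2 ℕ.≤ suc a) j → S (suc a) 2≤k (suc j) ≈ fromℕ (pathCount a a j)
  S≈pathCount a 2≤k j = begin
    fromℕ a * v * fromℕ (x C j)                 ≈⟨ solve 3 (λ a v B → a :* v :* B := v :* (a :* B))
                                                     refl _ v _ ⟩
    v * (fromℕ a * fromℕ (x C j))               ≈⟨ *-congˡ (×1-homo-* a (x C j)) ⟨
    v * fromℕ (a ℕ.* (x C j))                   ≈⟨ *-congˡ (fromℕ-cong ballot) ⟨
    v * fromℕ (x ℕ.* pathCount a a j)           ≈⟨ *-congˡ (×1-homo-* x (pathCount a a j)) ⟩
    v * (fromℕ x * fromℕ (pathCount a a j))     ≈⟨ solve 3 (λ v x N → v :* (x :* N) := x :* v :* N)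
                                                     refl v _ _ ⟩
    fromℕ x * v * fromℕ (pathCount a a j)       ≈⟨ *-congʳ (x*inv≈1 0<x) ⟩
    1# * fromℕ (pathCount a a j)                ≈⟨ *-identityˡ _ ⟩
    fromℕ (pathCount a a j)                     ∎
    where
    open ≈-Reasoning
    x = j ℕ.+ a ℕ.* suc j
    0<x : 0# < fromℕ x
    0<x = 0<fromℕ {x} (1≤ki-1 2≤k (ℕ.s≤s ℕ.z≤n))
    v = inv 0<x
    rearrange : ∀ a j → a ℕ.+ suc a ℕ.* j ≡ j ℕ.+ a ℕ.* suc j
    rearrange = solve-∀
    ballot : x ℕ.* pathCount a a j ≡ a ℕ.* (x C j)
    ballot = ≡.subst (λ y → y ℕ.* pathCount a a j ≡ a ℕ.* (y C j)) (rearrange a j)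
      (pathCount-ballot a a j)

  -- Expectation over the draws.

  -- `𝔼` with an arbitrary list in place of `allDraws n`, which makes induction along the list
  -- possible.
  weightedSum : Carrier → List (Vec Draw n) → (Vec Draw n → Carrier) → Carrier
  weightedSum p ωs X = List.foldr _+_ 0# (List.map (λ ω → prob p ω * X ω) ωs)

  weightedSum-++ : ∀ p (ωs ωs′ : List (Vec Draw n)) X →
                   weightedSum p (ωs ++ ωs′) X ≈ weightedSum p ωs X + weightedSum p ωs′ X
  weightedSum-++ p []       ωs′ X = sym (+-identityˡ _)
  weightedSum-++ p (ω ∷ ωs) ωs′ X =
    trans (+-congˡ (weightedSum-++ p ωs ωs′ X)) (sym (+-assoc _ _ _))

  weightedSum-∷ : ∀ p δ (ωs : List (Vec Draw n)) X →
                  weightedSum p (List.map (δ ∷_) ωs) X ≈ drawProb p δ * weightedSum p ωs (X ∘ (δ ∷_))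
  weightedSum-∷ p δ []       X = sym (zeroʳ (drawProb p δ))
  weightedSum-∷ p δ (ω ∷ ωs) X = trans (+-congˡ (weightedSum-∷ p δ ωs X))
    (solve 4 (λ e w x r → e :* w :* x :+ e :* r := e :* (w :* x :+ r)) refl
      (drawProb p δ) (prob p ω) (X (δ ∷ ω)) (weightedSum p ωs (X ∘ (δ ∷_))))

  weightedSum-cong : ∀ p (ωs : List (Vec Draw n)) {X Y} → (∀ ω → X ω ≈ Y ω) →
                     weightedSum p ωs X ≈ weightedSum p ωs Y
  weightedSum-cong p []       X≈Y = refl
  weightedSum-cong p (ω ∷ ωs) X≈Y = +-cong (*-congˡ (X≈Y ω)) (weightedSum-cong p ωs X≈Y)

  𝔼-cong : ∀ p n {X Y} → (∀ ω → X ω ≈ Y ω) → 𝔼 p n X ≈ 𝔼 p n Y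
  𝔼-cong p n = weightedSum-cong p (allDraws n)

  𝔼-suc : ∀ p n X → 𝔼 p (suc n) X ≈
          p * 𝔼 p n (X ∘ (largest ∷_)) + (1# - p) * 𝔼 p n (X ∘ (smallest ∷_))
  𝔼-suc p n X = trans
    (weightedSum-++ p (List.map (largest ∷_) (allDraws n)) (List.map (smallest ∷_) (allDraws n)) X)
    (+-cong (weightedSum-∷ p largest (allDraws n) X) (weightedSum-∷ p smallest (allDraws n) X))

  p+[1-p]≈1 : ∀ p → p + (1# - p) ≈ 1#
  p+[1-p]≈1 p = trans (+-comm p (1# - p)) (//-rightDividesˡ p 1#)

  mix-const : ∀ p x → p * x + (1# - p) * x ≈ x
  mix-const p x = trans (sym (distribʳ x p (1# - p))) (trans (*-congʳ (p+[1-p]≈1 p)) (*-identityˡ x))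

  𝔼-const : ∀ p n x → 𝔼 p n (λ _ → x) ≈ x
  𝔼-const p zero    x = trans (+-identityʳ _) (*-identityˡ x)
  𝔼-const p (suc n) x = trans (𝔼-suc p n (λ _ → x))
    (trans (+-cong (*-congˡ (𝔼-const p n x)) (*-congˡ (𝔼-const p n x))) (mix-const p x))

  -- The walk of the excess and the expected residue.

  module Walk (a : ℕ) (p u : Carrier) (q*u≈1 : (1# - p) * u ≈ 1#) where

    -- As `u` is 1/q, `α` and `β` are the constants k - 1/q and p/q of the theorem.
    q α β : Carrier
    q = 1# - p
    α = fromℕ (suc a) - u
    β = p * u

    -- The expected number of steps forced upwards at 0 in the walk on d with steps -1 and
    -- +a which starts at d and is stopped at its m-th step upwards.
    visits : (m d : ℕ) → Carrier
    visits zero    d       = 0#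
    visits (suc m) zero    = 1# + visits m a
    visits (suc m) (suc d) = p * visits (suc m) d + q * visits m (suc d ℕ.+ a)

    -- The claimed expected residue from excess `d` with `m` matches in a smallest box.
    value : (m d : ℕ) → Carrier
    value m d = fromℕ d + (fromℕ m * α + visits m d * β)

    α+u≈k : α + u ≈ fromℕ (suc a)
    α+u≈k = //-rightDividesˡ u (fromℕ (suc a))

    -- Holds because 1/q - p/q = 1. It is the balance at 0: the forced step raises the excess by `a`
    -- and uses up one unit of `m` and one visit.
    α+β≈a : α + β ≈ fromℕ a
    α+β≈a = +-cancelʳ 1# (α + β) (fromℕ a) (begin
      α + p * u + 1#          ≈⟨ +-congˡ q*u≈1 ⟨
      α + p * u + q * u       ≈⟨ +-assoc α (p * u) (q * u) ⟩
      α + (p * u + q * u)     ≈⟨ +-congˡ (mix-const p u) ⟩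
      α + u                   ≈⟨ α+u≈k ⟩
      1# + fromℕ a            ≈⟨ +-comm 1# (fromℕ a) ⟩
      fromℕ a + 1#            ∎)
      where open ≈-Reasoning

    -- The balance off 0: the mean change q a - p = q k - 1 of the excess equals q `α`, the mean
    -- loss in the term m `α`.
    qk≈qα+1 : q * fromℕ (suc a) ≈ q * α + 1#
    qk≈qα+1 = trans (*-congˡ (sym α+u≈k)) (trans (distribˡ q α u) (+-congˡ q*u≈1))

    value-zero : ∀ d → value 0 d ≈ fromℕ d
    value-zero d = solve 3 (λ D α β → D :+ (con 0 :* α :+ con 0 :* β) := D) refl (fromℕ d) α β

    value-reflect : ∀ m → value (suc m) 0 ≈ value m a
    value-reflect m = begin
      0# + ((1# + fromℕ m) * α + (1# + visits m a) * β)
        ≈⟨ solve 4 (λ M g α β → con 0 :+ ((con 1 :+ M) :* α :+ (con 1 :+ g) :* β) :=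
                                α :+ β :+ (M :* α :+ g :* β)) refl (fromℕ m) (visits m a) α β ⟩
      α + β + (fromℕ m * α + visits m a * β)
        ≈⟨ +-congʳ α+β≈a ⟩
      value m a ∎
      where open ≈-Reasoning

    value-step : ∀ m d → value (suc m) (suc d) ≈ p * value (suc m) d + q * value m (suc d ℕ.+ a)
    value-step m d = sym (begin
      p * (D + ((1# + μ) * α + g * β)) + q * (fromℕ (suc d ℕ.+ a) + (μ * α + h * β))
        ≈⟨ +-congˡ (*-congˡ (+-congʳ (trans (fromℕ-cong (≡.sym (ℕ.+-suc d a)))
             (×-homo-+ 1# d (suc a))))) ⟩
      p * (D + ((1# + μ) * α + g * β)) + q * (D + fromℕ (suc a) + (μ * α + h * β))
        ≈⟨ solve 9 (λ p q D μ α β g h K →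
             p :* (D :+ ((con 1 :+ μ) :* α :+ g :* β)) :+ q :* (D :+ K :+ (μ :* α :+ h :* β)) :=
             p :* (D :+ μ :* α) :+ q :* (D :+ μ :* α) :+ (p :* α :+ q :* K) :+ (p :* g :+ q :* h) :* β)
             refl p q D μ α β g h (fromℕ (suc a)) ⟩
      p * (D + μ * α) + q * (D + μ * α) + (p * α + q * fromℕ (suc a)) + (p * g + q * h) * β
        -- By `qk≈qα+1`, p α + q k = (p α + q α) + 1 = α + 1.
        ≈⟨ +-congʳ (+-cong (mix-const p _) (trans (+-congˡ qk≈qα+1)
             (trans (sym (+-assoc _ _ _)) (+-congʳ (mix-const p α))))) ⟩
      D + μ * α + (α + 1#) + (p * g + q * h) * β
        ≈⟨ solve 5 (λ D μ α β G → D :+ μ :* α :+ (α :+ con 1) :+ G :* β :=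
                                  con 1 :+ D :+ ((con 1 :+ μ) :* α :+ G :* β)) refl
             D μ α β (p * g + q * h) ⟩
      1# + D + ((1# + μ) * α + (p * g + q * h) * β) ∎)
      where
      open ≈-Reasoning
      D = fromℕ d
      μ = fromℕ m
      g = visits (suc m) d
      h = visits m (suc d ℕ.+ a)

    -- Induction on the remaining draws `N`, which suffice because each draw before the stop lowers
    -- the total. `past` and `i` vary, so the way of breaking ties does not affect the value.
    𝔼-residue : ∀ N (τ : TieBreaking (suc a)) past {c i m d} → Balanced c i m d → Vec.sum c ℕ.≤ N →
                𝔼 p N (λ ω → fromℕ (residue (run τ past c ω))) ≈ value m d
    𝔼-residue N τ past {c} {i} {zero} {d} b le = begin
      𝔼 p N (λ ω → fromℕ (residue (run τ past c ω)))
        ≈⟨ 𝔼-cong p N (λ ω → fromℕ-cong (≡.cong residue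
             (run-empty τ past ω (anyEmpty c i (bottom b))))) ⟩
      𝔼 p N (λ _ → fromℕ (Vec.sum c))
        ≈⟨ 𝔼-const p N _ ⟩
      fromℕ (Vec.sum c)
        ≈⟨ fromℕ-cong (≡.trans (total b)
             (≡.trans (≡.cong (d ℕ.+_) (ℕ.*-zeroʳ (suc a))) (ℕ.+-identityʳ d))) ⟩
      fromℕ d
        ≈⟨ value-zero d ⟨
      value 0 d ∎
      where
      open ≈-Reasoning
      open Balanced
    -- No draws left would mean no matches left, whereas a smallest box still holds `suc m`.
    𝔼-residue zero    τ past {c} {m = suc m} b le = contradiction (sum≤0 c le) (balanced-nonempty b)
    𝔼-residue (suc N) τ past {c} {m = suc m} b le = trans step (recurrence b)
      where
      ¬e : ¬ SomeEmpty c
      ¬e = balanced-nonempty b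
      next : Draw → Config (suc a)
      next δ = removeFrom c (proj₁ (τ past δ c))
      rest : Draw → Carrier
      rest δ = 𝔼 p N (λ ω → fromℕ (residue (run τ (δ ∷ past) (next δ) ω)))
      step : 𝔼 p (suc N) (λ ω → fromℕ (residue (run τ past c ω))) ≈
             p * rest largest + q * rest smallest
      step = trans (𝔼-suc p N _) (+-cong (*-congˡ (after largest)) (*-congˡ (after smallest)))
        where
        after : ∀ δ → 𝔼 p N (λ ω → fromℕ (residue (run τ past c (δ ∷ ω)))) ≈ rest δ
        after δ = 𝔼-cong p N λ ω → fromℕ-cong (≡.cong residue (run-nonempty τ past δ ω ¬e))
      continue : ∀ δ {i m d} → Balanced (next δ) i m d → rest δ ≈ value m d
      continue δ b′ = 𝔼-residue N τ (δ ∷ past) b′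
        (ℕ.s≤s⁻¹ (≡.subst (ℕ._≤ suc N) (≡.sym (sum-removeFrom c _ (¬e ∘ anyEmpty c _))) le))
      recurrence : ∀ {i d} → Balanced c i (suc m) d →
                   p * rest largest + q * rest smallest ≈ value (suc m) d
      recurrence {d = zero} b = begin
        p * rest largest + q * rest smallest  ≈⟨ +-cong (*-congˡ (down largest))
                                                        (*-congˡ (down smallest)) ⟩
        p * value m a + q * value m a         ≈⟨ mix-const p _ ⟩
        value m a                             ≈⟨ value-reflect m ⟨
        value (suc m) 0                       ∎
        where
        open ≈-Reasoning
        -- At excess 0 both draws remove from a smallest box and lead to the same state.
        down : ∀ δ → rest δ ≈ value m a
        down δ = continue δ (removeFrom-smallest (recentre (smallest-of-level b _) b))
      recurrence {d = suc d} b = trans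
        (+-cong (*-congˡ (continue largest (removeFrom-largest b (proj₂ (τ past largest c)))))
                (*-congˡ (continue smallest (removeFrom-smallest
                  (recentre (proj₂ (τ past smallest c)) b)))))
        (sym (value-step m d))

    -- First passage to 0 and the renewal equation.

    -- The probability of first reaching 0 from d after exactly j steps upwards.
    passage : ℕ → Series
    passage d j = p ^ d * (p ^ a * q) ^ j * fromℕ (pathCount a d j)

    returns : Series
    returns m = visits m 0

    passage-zero : passage 0 ≋ 𝟙
    passage-zero zero    = solve 0 (con 1 :* con 1 :* (con 1 :+ con 0) := con 1) refl
    passage-zero (suc j) = zeroʳ _

    -- Decomposition by the first step. A step +a costs a factor z because the series is indexed by
    -- the number of steps upwards.
    passage-suc : ∀ d → passage (suc d) ≋ p · passage d ⊕ q · (Z ⊛ passage (suc d ℕ.+ a))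
    passage-suc d zero = begin
      p * p ^ d * 1# * (1# + 0#)
        ≈⟨ solve 3 (λ p P q → p :* P :* con 1 :* (con 1 :+ con 0) :=
                              p :* (P :* con 1 :* (con 1 :+ con 0)) :+ q :* con 0) refl p (p ^ d) q ⟩
      p * passage d 0 + q * 0#
        ≈⟨ +-congˡ (*-congˡ (Z⊛-zero (passage (suc d ℕ.+ a)))) ⟨
      p * passage d 0 + q * (Z ⊛ passage (suc d ℕ.+ a)) 0 ∎
      where open ≈-Reasoning
    passage-suc d (suc j) = begin
      p * P * (A * q * R) * fromℕ (pathCount a d (suc j) ℕ.+ pathCount a (suc d ℕ.+ a) j)
        ≈⟨ *-congˡ (×-homo-+ 1# (pathCount a d (suc j)) (pathCount a (suc d ℕ.+ a) j)) ⟩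
      p * P * (A * q * R) * (N + N′)
        ≈⟨ solve 7 (λ p q P A R N N′ → p :* P :* (A :* q :* R) :* (N :+ N′) :=
             p :* (P :* (A :* q :* R) :* N) :+ q :* (p :* P :* A :* R :* N′)) refl p q P A R N N′ ⟩
      p * (P * (A * q * R) * N) + q * (p * P * A * R * N′)
        -- One factor p^a q has been split: its p^a completes the power of p for the higher start,
        -- its q is the step +a.
        ≈⟨ +-congˡ (*-congˡ (*-congʳ (*-congʳ (^-homo-* p (suc d) a)))) ⟨
      p * passage d (suc j) + q * passage (suc d ℕ.+ a) j
        ≈⟨ +-congˡ (*-congˡ (Z⊛-suc (passage (suc d ℕ.+ a)) j)) ⟨
      p * passage d (suc j) + q * (Z ⊛ passage (suc d ℕ.+ a)) (suc j) ∎
      where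
      open ≈-Reasoning
      P = p ^ d
      A = p ^ a
      R = (p ^ a * q) ^ j
      N = fromℕ (pathCount a d (suc j))
      N′ = fromℕ (pathCount a (suc d ℕ.+ a) j)

    -- The Markov property at the first arrival at 0: nothing is counted before it, and after j
    -- steps upwards m - j are left. Both sides obey the same first-step recurrence, whence
    -- induction on `m` and then `d`.
    visits≈passage⊛returns : ∀ m d → visits m d ≈ (passage d ⊛ returns) m
    visits≈passage⊛returns zero    d       = sym (trans (+-identityʳ _) (zeroʳ (passage d 0)))
    visits≈passage⊛returns (suc m) zero    = sym (trans
      (⊛-cong passage-zero (Series-ring.refl {returns}) (suc m)) (⊛-identityˡ returns (suc m)))
    visits≈passage⊛returns (suc m) (suc d) = begin
      p * visits (suc m) d + q * visits m (suc d ℕ.+ a)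
        ≈⟨ +-cong (*-congˡ (visits≈passage⊛returns (suc m) d))
             (*-congˡ (visits≈passage⊛returns m (suc d ℕ.+ a))) ⟩
      p * (passage d ⊛ returns) (suc m) + q * (A ⊛ returns) m
        ≈⟨ +-cong (·-⊛ p (passage d) returns (suc m)) (*-congˡ Z⊛A⊛returns) ⟨
      ((p · passage d) ⊛ returns) (suc m) + q * ((Z ⊛ A) ⊛ returns) (suc m)
        ≈⟨ +-congˡ (·-⊛ q (Z ⊛ A) returns (suc m)) ⟨
      ((p · passage d) ⊛ returns) (suc m) + ((q · (Z ⊛ A)) ⊛ returns) (suc m)
        ≈⟨ ⊛-distribʳ returns (p · passage d) (q · (Z ⊛ A)) (suc m) ⟨
      ((p · passage d ⊕ q · (Z ⊛ A)) ⊛ returns) (suc m)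
        ≈⟨ ⊛-cong (passage-suc d) (Series-ring.refl {returns}) (suc m) ⟨
      (passage (suc d) ⊛ returns) (suc m) ∎
      where
      open ≈-Reasoning
      A = passage (suc d ℕ.+ a)
      Z⊛A⊛returns : ((Z ⊛ A) ⊛ returns) (suc m) ≈ (A ⊛ returns) m
      Z⊛A⊛returns = trans (⊛-assoc Z A returns (suc m)) (Z⊛-suc (A ⊛ returns) m)

    -- The series W(z). The step upwards from 0 is forced, so it contributes z without q; this is
    -- where the factor 1/q in front of S comes from.
    firstReturn : Series
    firstReturn = Z ⊛ passage a

    -- `ones` counts the visit at the start; the forced step then leads to `a`, from where the walk
    -- has to reach 0 again.
    returns-renewal : returns ≋ ones ⊕ firstReturn ⊛ returns
    returns-renewal zero    = sym (trans (+-identityˡ _)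
      (trans (⊛-assoc Z (passage a) returns 0) (Z⊛-zero (passage a ⊛ returns))))
    returns-renewal (suc m) = +-congˡ (trans (visits≈passage⊛returns m a)
      (sym (trans (⊛-assoc Z (passage a) returns (suc m)) (Z⊛-suc (passage a ⊛ returns) m))))

    firstReturn≋S : (2≤k : 2 ℕ.≤ suc a) → const u ⊛ (S (suc a) 2≤k ⟨ p ^ a * q Z⟩) ≋ firstReturn
    firstReturn≋S 2≤k zero    = begin
      u * (1# * 0#) + 0#      ≈⟨ solve 1 (λ u → u :* (con 1 :* con 0) :+ con 0 := con 0) refl u ⟩
      0#                      ≈⟨ Z⊛-zero (passage a) ⟨
      (Z ⊛ passage a) 0       ∎
      where open ≈-Reasoning
    firstReturn≋S 2≤k (suc j) = begin
      (const u ⊛ (S (suc a) 2≤k ⟨ p ^ a * q Z⟩)) (suc j)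
        ≈⟨ const-⊛ u (S (suc a) 2≤k ⟨ p ^ a * q Z⟩) (suc j) ⟩
      u * (A * q * R * S (suc a) 2≤k (suc j))
        ≈⟨ *-congˡ (*-congˡ (S≈pathCount a 2≤k j)) ⟩
      u * (A * q * R * N)
        -- The power of p^a q is one higher than in `passage a j`; its p^a is the `p ^ a` there and
        -- its q cancels `u`.
        ≈⟨ solve 5 (λ u A q R N → u :* (A :* q :* R :* N) := q :* u :* (A :* R :* N)) refl u A q R N ⟩
      q * u * (A * R * N)
        ≈⟨ *-congʳ q*u≈1 ⟩
      1# * passage a j
        ≈⟨ *-identityˡ _ ⟩
      passage a j
        ≈⟨ Z⊛-suc (passage a) j ⟨
      (Z ⊛ passage a) (suc j) ∎
      where
      open ≈-Reasoning
      A = p ^ a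
      R = (p ^ a * q) ^ j
      N = fromℕ (pathCount a a j)

    returns≋ : (2≤k : 2 ℕ.≤ suc a) →
               returns ≋ (Z ⊘ (𝟙 ⊝ Z)) ⊘ (𝟙 ⊝ const u ⊛ (S (suc a) 2≤k ⟨ p ^ a * q Z⟩))
    returns≋ 2≤k = ⊘-unique
      (x-0≈x (trans (firstReturn≋S 2≤k 0) (Z⊛-zero (passage a))))
      λ n → begin
        ((𝟙 ⊝ W) ⊛ returns) n                                 ≈⟨ ⊛-distribʳ-⊝ returns 𝟙 W n ⟩
        (𝟙 ⊛ returns) n - (W ⊛ returns) n
          ≈⟨ +-cong (trans (⊛-identityˡ returns n) (returns-renewal n))
               (-‿cong (⊛-cong (firstReturn≋S 2≤k) (Series-ring.refl {returns}) n)) ⟩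
        ones n + (firstReturn ⊛ returns) n - (firstReturn ⊛ returns) n
          ≈⟨ //-rightDividesʳ ((firstReturn ⊛ returns) n) (ones n) ⟩
        ones n                                                ≈⟨ ones≋ n ⟩
        (Z ⊘ (𝟙 ⊝ Z)) n                                       ∎
      where
      open ≈-Reasoning
      W : Series
      W = const u ⊛ (S (suc a) 2≤k ⟨ p ^ a * q Z⟩)

    -- The generating function of the expected residues.

    M≈value : ∀ (τ : ℕ → TieBreaking (suc a)) n → M (suc a) τ p n ≈ value n 0
    -- The constant term of `M` is 0 by definition, and so is `value 0 0`.
    M≈value τ zero    = sym (value-zero 0)
    M≈value τ (suc n) = 𝔼-residue (suc a ℕ.* suc n) (τ (suc n)) []
      (balanced-replicate (suc n) zero) (ℕ.≤-reflexive (sum-replicate (suc a) (suc n)))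

    ⊛-const : ∀ f x n → (f ⊛ const x) n ≈ f n * x
    ⊛-const f x n = trans (⊛-comm f (const x) n) (trans (const-⊛ x f n) (*-comm x (f n)))

    M≋ : (2≤k : 2 ℕ.≤ suc a) (τ : ℕ → TieBreaking (suc a)) →
         M (suc a) τ p
           ≋ (Z ⊘ ((𝟙 ⊝ Z) ⊛ (𝟙 ⊝ Z))) ⊛ const α
             ⊕ (Z ⊘ (𝟙 ⊝ Z)) ⊛ const β
               ⊛ (𝟙 ⊘ (𝟙 ⊝ const u ⊛ (S (suc a) 2≤k ⟨ p ^ a * q Z⟩)))
    M≋ 2≤k τ n = begin
      M (suc a) τ p n
        ≈⟨ M≈value τ n ⟩
      0# + (fromℕ n * α + returns n * β)
        ≈⟨ +-identityˡ _ ⟩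
      fromℕ n * α + returns n * β
        ≈⟨ +-cong (*-congʳ (fromℕ≋ n)) (*-congʳ (returns≋ 2≤k n)) ⟩
      (Z ⊘ ((𝟙 ⊝ Z) ⊛ (𝟙 ⊝ Z))) n * α + (J ⊛ r) n * β
        ≈⟨ +-cong (⊛-const (Z ⊘ ((𝟙 ⊝ Z) ⊛ (𝟙 ⊝ Z))) α n) (⊛-const (J ⊛ r) β n) ⟨
      ((Z ⊘ ((𝟙 ⊝ Z) ⊛ (𝟙 ⊝ Z))) ⊛ const α) n + (J ⊛ r ⊛ const β) n
        ≈⟨ +-congˡ (swap n) ⟩
      ((Z ⊘ ((𝟙 ⊝ Z) ⊛ (𝟙 ⊝ Z))) ⊛ const α) n + (J ⊛ const β ⊛ (𝟙 ⊛ r)) n ∎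
      where
      open ≈-Reasoning
      J r : Series
      J = Z ⊘ (𝟙 ⊝ Z)
      r = recip (𝟙 ⊝ const u ⊛ (S (suc a) 2≤k ⟨ p ^ a * q Z⟩))
      swap : J ⊛ r ⊛ const β ≋ J ⊛ const β ⊛ (𝟙 ⊛ r)
      swap n = begin
        (J ⊛ r ⊛ const β) n        ≈⟨ ⊛-assoc J r (const β) n ⟩
        (J ⊛ (r ⊛ const β)) n      ≈⟨ ⊛-cong (Series-ring.refl {J}) (⊛-comm r (const β)) n ⟩
        (J ⊛ (const β ⊛ r)) n      ≈⟨ ⊛-assoc J (const β) r n ⟨
        (J ⊛ const β ⊛ r) n        ≈⟨ ⊛-cong (Series-ring.refl {J ⊛ const β}) (⊛-identityˡ r) n ⟨
        (J ⊛ const β ⊛ (𝟙 ⊛ r)) n  ∎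

theorem3p3 :
    ∀ {c ℓ₁ ℓ₂} (F : OrderedField c ℓ₁ ℓ₂) →
    let open OrderedField F
        open Over F
    in
    (k : ℕ) (2≤k : 2 ℕ.≤ k)
    (p : Carrier) (0<p : 0# < p) (p<1 : p < 1#)
    (τ : ℕ → TieBreaking k) →
    let q = 1# - p
        1/q = inv (0<y-x p<1)
    in
    M k τ p
      ≋ (Z ⊘ ((𝟙 ⊝ Z) ⊛ (𝟙 ⊝ Z))) ⊛ const (fromℕ k - 1/q)
        ⊕ (Z ⊘ (𝟙 ⊝ Z)) ⊛ const (p * 1/q)
          ⊛ (𝟙 ⊘ (𝟙 ⊝ const 1/q ⊛ (S k 2≤k ⟨ p ^ (k ℕ.∸ 1) * q Z⟩)))
theorem3p3 F (suc a) 2≤k p 0<p p<1 τ =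
  Walk.M≋ F a p (inv (0<y-x p<1)) (x*inv≈1 (0<y-x p<1)) 2≤k τ
  where open Over F
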